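{- Let $m\in\mathbb{N}$, let $\eta$ be a finite binomid index of length $m$, and let $\tilde\eta$ be its lex-minimal extension, with partial sums $(S_i)_{i\ge1}$ and averages $A_i=S_i/i$. Let $A_{\max}=\max\{A_i\mid 1\le i\le m\}$. Then the minimal period of $\tilde\eta$ is \[\gcd\big(\{i\in\mathbb{N}\mid i\le m,\ A_i=A_{\max}\}\big).\]
   Context: $\mathbb{N}=\{1,2,3,\dots\}$. A sequence $(e_i)_{i\le m}$ of nonnegative integers, where $m\in\mathbb{N}$ (finite sequence of length $m$) or $m=\infty$ (infinite sequence indexed by $\mathbb{N}$), is a binomid index if $\sum_{i=n-k+1}^{n}e_i\ge\sum_{i=1}^k e_i$ for all $k,n\in\mathbb{N}$ with $1\le k\le n\le m$. Every finite binomid index $\eta$ extends to an infinite binomid index having $\eta$ as its initial segment; among all such extensions there is a unique lexicographically minimal one, denoted $\tilde\eta$ and called the lex-minimal extension of $\eta$. The partial sums of $(e_i)_{i\ge1}$ are $S_i=e_1+\dots+e_i$. It is known that $\tilde\eta$ is eventually periodic, i.e. $\tilde\eta=\eta_0(\eta_1)^\infty$ for some finite sequences $\eta_0$ (possibly empty) and $\eta_1$ (nonempty). In such a representation $|\eta_0|$ is called a preperiod and $|\eta_1|$ a period of $\tilde\eta$; the minimal period is the smallest possible value of $|\eta_1|$. -}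

module Defs where

open import Data.Fin.Base using (Fin; toℕ)
open import Data.Integer.Base using (+_)
open import Data.List.Base using (List; map; foldr; filter; take; drop; applyUpTo; upTo)
open import Data.Nat.Base using (ℕ; zero; suc; _+_; _∸_; _≤_; _<_; NonZero)
open import Data.Nat.DivMod using (_mod_)
open import Data.Nat.GCD using (gcd)
open import Data.Nat.ListAction using (sum)
open import Data.Product.Base using (_×_; ∃-syntax)
open import Data.Rational.Base using (ℚ; _/_)
import Data.Rational.Properties as ℚ
open import Relation.Binary.Bundles using (DecTotalOrder)
open import Data.List.Extrema (DecTotalOrder.totalOrder ℚ.≤-decTotalOrder) using (max)
open import Data.Vec.Base using (Vec; []; _∷_; lookup; toList)
open import Relation.Binary.PropositionalEquality.Core using (_≡_; _≗_)
open import Relation.Nullary.Negation.Core using (¬_)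

-- Sequences are stored 0-based: e i is the term e_{i+1}.
Seq : Set
Seq = ℕ → ℕ

IsFiniteBinomidIndex : ∀ {m} → Vec ℕ m → Set
IsFiniteBinomidIndex {m} η = ∀ k n → 1 ≤ k → k ≤ n → n ≤ m →
  sum (take k (toList η)) ≤ sum (take k (drop (n ∸ k) (toList η)))

-- S e i = e_1 + … + e_i
S : Seq → ℕ → ℕ
S e i = sum (applyUpTo e i)

-- The right-hand side is e_{n-k+1} + … + e_n.
IsBinomidIndex : Seq → Set
IsBinomidIndex e = ∀ k n → 1 ≤ k → k ≤ n →
  S e k ≤ sum (applyUpTo (λ i → e (n ∸ k + i)) k)

record IsExtension {m} (η : Vec ℕ m) (e : Seq) : Set where
  field
    agrees  : ∀ (i : Fin m) → e (toℕ i) ≡ lookup η i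
    binomid : IsBinomidIndex e

infix 4 _<lex_
_<lex_ : Seq → Seq → Set
e <lex e′ = ∃[ n ] (∀ i → i < n → e i ≡ e′ i) × e n < e′ n

-- Minimality is the absence of a smaller extension.  The lexicographic order
-- is classically total, but asking for "e ≗ e′ or e <lex e′" would
-- constructively demand deciding equality of infinite sequences.
record IsLexMinExtension {m} (η : Vec ℕ m) (e : Seq) : Set where
  field
    isExtension : IsExtension η e
    minimal     : ∀ e′ → IsExtension η e′ → ¬ (e′ <lex e)

infixr 5 _++ˢ_
_++ˢ_ : ∀ {p} → Vec ℕ p → Seq → Seq
([]       ++ˢ e) i       = e i
((x ∷ xs) ++ˢ e) zero    = x
((x ∷ xs) ++ˢ e) (suc i) = (xs ++ˢ e) i

infix 6 _^∞
_^∞ : ∀ {d} → .{{NonZero d}} → Vec ℕ d → Seq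
_^∞ {d} η i = lookup η (i mod d)

record IsPeriod (e : Seq) (d : ℕ) : Set where
  field
    {{d≢0}}        : NonZero d
    {preperiod}    : ℕ
    η₀             : Vec ℕ preperiod
    η₁             : Vec ℕ d
    representation : e ≗ η₀ ++ˢ η₁ ^∞

record IsMinimalPeriod (e : Seq) (d : ℕ) : Set where
  field
    isPeriod : IsPeriod e d
    least    : ∀ d′ → IsPeriod e d′ → d ≤ d′

A : Seq → (i : ℕ) → .{{NonZero i}} → ℚ
A e i = + S e i / i

-- max {A_i ∣ 1 ≤ i ≤ m} for m ≥ 1; the first argument of max is the value for
-- the empty list, and A e 1 is itself one of the averages when m ≥ 1.
Amax : Seq → ℕ → ℚ
Amax e m = max (A e 1) (applyUpTo (λ j → A e (suc j)) m)

-- The i with 1 ≤ i ≤ m and A_i = Amax, in increasing order.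
maximisers : Seq → ℕ → List ℕ
maximisers e m = map suc (filter (λ j → A e (suc j) ℚ.≟ Amax e m) (upTo m))

gcdList : List ℕ → ℕ
gcdList = foldr gcd 0

{-# OPTIONS --safe #-}
module Submission where

-- A sequence is a binomid index exactly when its partial sums S are superadditive,
-- and lex-minimality forces S_n = S_k + S_{n-k} for some 1 ≤ k ≤ m whenever n > m.
-- Let M ≤ m attain the maximal average.  The deficits n S_M − M S_n are then
-- nonnegative and subadditive, and vanish for n ≤ m exactly at the maximisers (and 0).
-- Shifting by a maximiser i does not increase them, so they are eventually
-- i-periodic; hence so is the sequence, and gcds of eventual periods are eventual
-- periods.  Conversely, a period d gives a vanishing deficit at some N M + d, so
-- N M + d is a sum of maximisers and the gcd divides d.

open import Data.Nat.Properties
open import Algebra.Properties.CommutativeSemigroup +-commutativeSemigroup using (xy∙z≈xz∙y; x∙yz≈xz∙y)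
open import Data.Fin.Base using (Fin; toℕ)
open import Data.Fin.Properties using (toℕ<n; toℕ-fromℕ<; toℕ-injective)
import Data.Integer.Base as ℤ
import Data.Integer.Properties as ℤ
open import Data.List.Base using ([]; _∷_; applyUpTo; upTo)
open import Data.List.Membership.Propositional using (_∈_)
open import Data.List.Membership.Propositional.Properties
  using (∈-map∘filter⁻; ∈-map∘filter⁺; ∈-applyUpTo⁺; ∈-applyUpTo⁻; ∈-upTo⁺; ∈-upTo⁻)
open import Data.List.Relation.Unary.All as All using ()
open import Data.List.Relation.Unary.Any using (here; there)
open import Data.Nat.Base
open import Data.Nat.Divisibility
open import Data.Nat.DivMod using (_mod_; _%_; _/_; m%n<n; [m+n]%n≡m%n; m≡m%n+[m/n]*n)
open import Data.Nat.GCD using (gcd; gcd-GCD; gcd[m,n]∣m; gcd[m,n]∣n; module Bézout)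
open import Data.Nat.Induction using (Acc; acc; <-wellFounded; <-rec)
open import Data.Nat.Tactic.RingSolver using (solve-∀)
open import Data.Product.Base using (_×_; _,_; ∃-syntax)
open import Data.Rational.Base as ℚ using (fromℚᵘ)
import Data.Rational.Properties as ℚ
open import Data.Rational.Unnormalised.Base as ℚᵘ using (mkℚᵘ; *≡*)
import Data.Rational.Unnormalised.Properties as ℚᵘ
open import Data.Sum.Base using (_⊎_; inj₁; inj₂; [_,_]′)
open import Data.Vec.Base using (Vec; []; _∷_; lookup; tabulate)
open import Data.Vec.Properties using (lookup∘tabulate)
open import Function.Base using (_∘_; id)
open import Relation.Binary.Bundles using (DecTotalOrder)
open import Data.List.Extrema (DecTotalOrder.totalOrder ℚ.≤-decTotalOrder)
  using (argmax-sel; xs≤max)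
open import Relation.Binary.PropositionalEquality
  using (_≡_; _≢_; _≗_; refl; sym; trans; cong; cong₂; subst; subst₂; module ≡-Reasoning)
open import Relation.Nullary using (yes; no; contradiction)
open import Defs

-- Partial sums of sequences

S-+ : ∀ e a b → S e (a + b) ≡ S e a + S (λ i → e (a + i)) b
S-+ e zero    b = refl
S-+ e (suc a) b = trans (cong (e 0 +_) (S-+ (e ∘ suc) a b)) (sym (+-assoc (e 0) _ _))

S-suc : ∀ e n → S e (suc n) ≡ S e n + e n
S-suc e n = begin
  S e (suc n)            ≡⟨ cong (S e) (+-comm 1 n) ⟩
  S e (n + 1)            ≡⟨ S-+ e n 1 ⟩
  S e n + (e (n + 0) + 0) ≡⟨ cong (S e n +_) (trans (+-identityʳ _) (cong e (+-identityʳ n))) ⟩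
  S e n + e n            ∎
  where open ≡-Reasoning

-- The dichotomy behind the descent on deficits: a pointwise decrease either changes nothing on the
-- first `n` entries or strictly lowers their sum, so it can be strict only finitely often.
≤-pointwise-S : ∀ {f g} n → (∀ i → f i ≤ g i) →
  (∀ i → i < n → f i ≡ g i) ⊎ S f n < S g n
≤-pointwise-S zero f≤g = inj₁ λ _ ()
≤-pointwise-S (suc n) f≤g with m≤n⇒m<n∨m≡n (f≤g 0) | ≤-pointwise-S n (f≤g ∘ suc)
... | inj₁ f₀<g₀ | inj₁ eq = inj₂ (+-mono-<-≤ f₀<g₀ (≤-reflexive (S-cong n eq)))
  where
  S-cong : ∀ {f g} n → (∀ i → i < n → f i ≡ g i) → S f n ≡ S g n
  S-cong zero    eq = refl
  S-cong (suc n) eq = cong₂ _+_ (eq 0 z<s) (S-cong n λ i i<n → eq (suc i) (s<s i<n))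
... | inj₁ f₀<g₀ | inj₂ lt = inj₂ (+-mono-< f₀<g₀ lt)
... | inj₂ f₀≡g₀ | inj₂ lt = inj₂ (+-mono-≤-< (≤-reflexive f₀≡g₀) lt)
... | inj₂ f₀≡g₀ | inj₁ eq = inj₁ λ where
  zero    _         → f₀≡g₀
  (suc i) (s<s i<n) → eq i i<n

-- Binomid indices as superadditive partial sums

Superadditive : (ℕ → ℕ) → Set
Superadditive T = ∀ a b → T a + T b ≤ T (a + b)

superadditive⇒mono : ∀ T → Superadditive T → ∀ n → T n ≤ T (suc n)
superadditive⇒mono T sup n = m+n≤o⇒n≤o (T 1) (sup 1 n)

superadditive⇒T0≡0 : ∀ T → Superadditive T → T 0 ≡ 0
superadditive⇒T0≡0 T sup =
  n≤0⇒n≡0 (+-cancelˡ-≤ (T 0) (T 0) 0 (≤-trans (sup 0 0) (≤-reflexive (sym (+-identityʳ (T 0))))))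

differences : (ℕ → ℕ) → Seq
differences T n = T (suc n) ∸ T n

-- Superadditivity makes `T` monotone with `T 0 ≡ 0`, so the truncated differences are exact and
-- telescope.
S-differences : ∀ T → Superadditive T → ∀ n → S (differences T) n ≡ T n
S-differences T sup zero    = sym (superadditive⇒T0≡0 T sup)
S-differences T sup (suc n) = begin
  S (differences T) (suc n)         ≡⟨ S-suc (differences T) n ⟩
  S (differences T) n + differences T n ≡⟨ cong (_+ differences T n) (S-differences T sup n) ⟩
  T n + (T (suc n) ∸ T n)           ≡⟨ m+[n∸m]≡n (superadditive⇒mono T sup n) ⟩
  T (suc n)                         ∎
  where open ≡-Reasoning

-- The binomid inequality with `k = b` and `n = a + b` compares the first `b` terms with the `b`
-- terms that follow the first `a`. It speaks only of `k ≥ 1`, hence the separate case `b = 0`.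
binomid⇒superadditive : ∀ {e} → IsBinomidIndex e → Superadditive (S e)
binomid⇒superadditive {e} bin a zero = ≤-reflexive (trans (+-identityʳ _) (cong (S e) (sym (+-identityʳ a))))
binomid⇒superadditive {e} bin a b@(suc _) = begin
  S e a + S e b                    ≤⟨ +-monoʳ-≤ (S e a) (bin b (a + b) z<s (m≤n+m b a)) ⟩
  S e a + S (λ i → e (a + b ∸ b + i)) b ≡⟨ cong (λ c → S e a + S (λ i → e (c + i)) b) (m+n∸n≡m a b) ⟩
  S e a + S (λ i → e (a + i)) b    ≡⟨ S-+ e a b ⟨
  S e (a + b)                      ∎
  where open ≤-Reasoning

superadditive⇒binomid : ∀ {e} → Superadditive (S e) → IsBinomidIndex e
superadditive⇒binomid {e} sup k n _ k≤n = +-cancelˡ-≤ (S e (n ∸ k)) _ _ (begin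
  S e (n ∸ k) + S e k                       ≤⟨ sup (n ∸ k) k ⟩
  S e (n ∸ k + k)                           ≡⟨ S-+ e (n ∸ k) k ⟩
  S e (n ∸ k) + S (λ i → e (n ∸ k + i)) k   ∎)
  where open ≤-Reasoning

-- Lex-minimality forces decompositions

lowerAt : ℕ → (ℕ → ℕ) → ℕ → ℕ
lowerAt n T j with j ≟ n
... | yes _ = pred (T j)
... | no  _ = T j

lowerAt-≤ : ∀ n T j → lowerAt n T j ≤ T j
lowerAt-≤ n T j with j ≟ n
... | yes _ = pred[n]≤n
... | no  _ = ≤-refl

lowerAt-≡ : ∀ n T → lowerAt n T n ≡ pred (T n)
lowerAt-≡ n T with n ≟ n
... | yes _ = refl
... | no n≢n = contradiction refl n≢n

lowerAt-≢ : ∀ {n j} T → j ≢ n → lowerAt n T j ≡ T j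
lowerAt-≢ {n} {j} T j≢n with j ≟ n
... | yes j≡n = contradiction j≡n j≢n
... | no _    = refl

-- Lowering a value can only hurt the inequalities whose total argument is `suc p`. When both
-- summands are positive, `exceeds` leaves a slack of at least one there; when one is zero, its
-- value is 0 and the inequality is trivial.
lowerAt-superadditive : ∀ {T p} → Superadditive T →
  (∀ i → i < p → T (suc i) + T (p ∸ i) < T (suc p)) →
  Superadditive (lowerAt (suc p) T)
lowerAt-superadditive {T} {p} sup exceeds = λ where
    zero    b       → +-monoˡ-≤ (T′ b) T′0≤0
    a       zero    → begin
      T′ a + T′ 0  ≤⟨ +-monoʳ-≤ (T′ a) T′0≤0 ⟩
      T′ a + 0     ≡⟨ trans (+-identityʳ (T′ a)) (cong T′ (sym (+-identityʳ a))) ⟩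
      T′ (a + 0)   ∎
    (suc i) (suc j) → positive i j
  where
  open ≤-Reasoning
  T′ = lowerAt (suc p) T
  T′0≤0 : T′ 0 ≤ 0
  T′0≤0 = ≤-trans (lowerAt-≤ (suc p) T 0) (≤-reflexive (superadditive⇒T0≡0 T sup))
  positive : ∀ i j → T′ (suc i) + T′ (suc j) ≤ T′ (suc i + suc j)
  positive i j with i + suc j ≟ p
  ... | no i+1+j≢p = begin
    T′ (suc i) + T′ (suc j)  ≤⟨ +-mono-≤ (lowerAt-≤ (suc p) T (suc i)) (lowerAt-≤ (suc p) T (suc j)) ⟩
    T (suc i) + T (suc j)    ≤⟨ sup (suc i) (suc j) ⟩
    T (suc i + suc j)        ≡⟨ lowerAt-≢ T (i+1+j≢p ∘ suc-injective) ⟨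
    T′ (suc i + suc j)       ∎
  ... | yes refl = begin
    T′ (suc i) + T′ (suc j)      ≤⟨ +-mono-≤ (lowerAt-≤ (suc p) T (suc i)) (lowerAt-≤ (suc p) T (suc j)) ⟩
    T (suc i) + T (suc j)        ≡⟨ cong (λ k → T (suc i) + T k) (m+n∸m≡n i (suc j)) ⟨
    T (suc i) + T (p ∸ i)        ≤⟨ <⇒≤pred (exceeds i (m<m+n i z<s)) ⟩
    pred (T (suc p))             ≡⟨ lowerAt-≡ (suc p) T ⟨
    T′ (suc p)                   ∎

-- If S_{p+1} exceeded every S_k + S_{p+1-k}, lowering it by one and leaving all
-- other partial sums unchanged would give a smaller extension.
lexMin⇒decomposable : ∀ {m} {η : Vec ℕ m} {e} → .{{NonZero m}} → IsLexMinExtension η e →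
  ∀ p → m ≤ p → ∃[ i ] i < p × S e (suc p) ≤ S e (suc i) + S e (p ∸ i)
lexMin⇒decomposable {m} {η} {e} lexMin p m≤p
  -- The search over `i < p` runs through all splittings of `suc p` into positive parts `suc i` and
  -- `p ∸ i`. It is decidable, so the negative form of minimality suffices to rule out failure.
  with anyUpTo? (λ i → S e (suc p) ≤? S e (suc i) + S e (p ∸ i)) p
... | yes found = found
... | no ¬found = contradiction (p , before , at-p) (minimal e′ record
  { agrees  = λ i → trans (before (toℕ i) (<-≤-trans (toℕ<n i) m≤p)) (agrees i)
  ; binomid = superadditive⇒binomid λ a b →
      subst₂ _≤_ (sym (cong₂ _+_ (S-e′ a) (S-e′ b))) (sym (S-e′ (a + b))) (sup′ a b)
  })
  where
  open IsLexMinExtension lexMin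
  open IsExtension isExtension
  sup = binomid⇒superadditive binomid

  exceeds : ∀ i → i < p → S e (suc i) + S e (p ∸ i) < S e (suc p)
  exceeds i i<p = ≰⇒> λ le → ¬found (i , i<p , le)

  T′ = lowerAt (suc p) (S e)
  e′ = differences T′
  sup′ : Superadditive T′
  sup′ = lowerAt-superadditive sup exceeds
  S-e′ : ∀ n → S e′ n ≡ T′ n
  S-e′ = S-differences T′ sup′

  S-∸ : ∀ i → S e (suc i) ∸ S e i ≡ e i
  S-∸ i = trans (cong (_∸ S e i) (S-suc e i)) (m+n∸m≡n (S e i) (e i))

  before : ∀ i → i < p → e′ i ≡ e i
  before i i<p = trans
    (cong₂ _∸_ (lowerAt-≢ (S e) (<⇒≢ (s<s i<p))) (lowerAt-≢ (S e) (<⇒≢ (m<n⇒m<1+n i<p))))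
    (S-∸ i)

  0<p : 0 < p
  0<p = <-≤-trans (>-nonZero⁻¹ m) m≤p

  -- The splitting into 1 and `p` shows that the term at `p` is positive; otherwise truncated
  -- subtraction would hide the lowering.
  Sp<Ssp : S e p < S e (suc p)
  Sp<Ssp = m+n≤o⇒n≤o (S e 1) (subst (_≤ S e (suc p)) (sym (+-suc (S e 1) (S e p))) (exceeds 0 0<p))

  at-p : e′ p < e p
  at-p = begin-strict
    e′ p                        ≡⟨ cong₂ _∸_ (lowerAt-≡ (suc p) (S e)) (lowerAt-≢ (S e) (<⇒≢ (n<1+n p))) ⟩
    pred (S e (suc p)) ∸ S e p  <⟨ ∸-monoˡ-< (pred< _ Sp<Ssp) (<⇒≤pred Sp<Ssp) ⟩
    S e (suc p) ∸ S e p         ≡⟨ S-∸ p ⟩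
    e p                         ∎
    where
    open ≤-Reasoning
    pred< : ∀ {k} n → k < n → pred n < n
    pred< (suc n) _ = n<1+n n

DecomposableBeyond : ℕ → (ℕ → ℕ) → Set
DecomposableBeyond m T = ∀ n → m < n →
  ∃[ k ] ∃[ l ] 1 ≤ k × k ≤ m × k + l ≡ n × T n ≤ T k + T l

-- A splitting may have a first part larger than `m`. By strong induction that part has a piece
-- `k ≤ m` to split off, and superadditivity merges its remainder with the second part.
lexMin⇒decomposableBeyond : ∀ {m} {η : Vec ℕ m} {e} → .{{NonZero m}} → IsLexMinExtension η e →
  DecomposableBeyond m (S e)
lexMin⇒decomposableBeyond {m} {η} {e} lexMin = <-rec _ step
  where
  open ≤-Reasoning
  sup = binomid⇒superadditive (IsExtension.binomid (IsLexMinExtension.isExtension lexMin))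

  P : ℕ → Set
  P n = m < n → ∃[ k ] ∃[ l ] 1 ≤ k × k ≤ m × k + l ≡ n × S e n ≤ S e k + S e l

  step : ∀ n → (∀ {j} → j < n → P j) → P n
  step (suc p) rec (s≤s m≤p) with lexMin⇒decomposable lexMin p m≤p
  ... | i , i<p , le with suc i ≤? m
  ...   | yes 1+i≤m = suc i , p ∸ i , z<s , 1+i≤m , cong suc (m+[n∸m]≡n (<⇒≤ i<p)) , le
  ...   | no  1+i≰m with rec (s<s i<p) (≰⇒> 1+i≰m)
  ...     | k , l , 1≤k , k≤m , k+l≡1+i , le′ =
    k , l + (p ∸ i) , 1≤k , k≤m ,
    trans (sym (+-assoc k l (p ∸ i))) (trans (cong (_+ (p ∸ i)) k+l≡1+i) (cong suc (m+[n∸m]≡n (<⇒≤ i<p)))) ,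
    (begin
      S e (suc p)                   ≤⟨ le ⟩
      S e (suc i) + S e (p ∸ i)     ≤⟨ +-monoˡ-≤ _ le′ ⟩
      S e k + S e l + S e (p ∸ i)   ≡⟨ +-assoc (S e k) _ _ ⟩
      S e k + (S e l + S e (p ∸ i)) ≤⟨ +-monoʳ-≤ (S e k) (sup l (p ∸ i)) ⟩
      S e k + S e (l + (p ∸ i))     ∎)

-- Maximal averages, tight indices and deficits

module MaximalAverage {T m M} (sup : Superadditive T) (dec : DecomposableBeyond m T)
  (maximal : ∀ i → 1 ≤ i → i ≤ m → M * T i ≤ i * T M) where

  -- The bound on averages, cross-multiplied to stay in ℕ, extends beyond `m`: split off a piece
  -- `k ≤ m`, bounded by `maximal`, and induct on the rest.
  average-≤ : ∀ n → M * T n ≤ n * T M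
  average-≤ = <-rec _ step
    where
    open ≤-Reasoning
    small : ∀ n → n ≤ m → M * T n ≤ n * T M
    small zero    _   = ≤-reflexive (trans (cong (M *_) (superadditive⇒T0≡0 T sup)) (*-zeroʳ M))
    small (suc n) n<m = maximal (suc n) z<s n<m
    step : ∀ n → (∀ {j} → j < n → M * T j ≤ j * T M) → M * T n ≤ n * T M
    step n rec with n ≤? m
    ... | yes n≤m = small n n≤m
    ... | no  n≰m with dec n (≰⇒> n≰m)
    ...   | k , l , 1≤k , k≤m , refl , le = begin
      M * T (k + l)      ≤⟨ *-monoʳ-≤ M le ⟩
      M * (T k + T l)    ≡⟨ *-distribˡ-+ M (T k) (T l) ⟩
      M * T k + M * T l  ≤⟨ +-mono-≤ (maximal k 1≤k k≤m) (rec (m<n+m l 1≤k)) ⟩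
      k * T M + l * T M  ≡⟨ *-distribʳ-+ (T M) k l ⟨
      (k + l) * T M      ∎

  -- S_n / n equals the maximal average S_M / M, or n = 0.
  Tight : ℕ → Set
  Tight n = M * T n ≡ n * T M

  -- Superadditivity gives `k * T M ≤ T (k * M)`, the reverse of the general bound on averages.
  tight-* : ∀ k → Tight (k * M)
  tight-* k = ≤-antisym (average-≤ (k * M)) (begin
    k * M * T M      ≡⟨ cong (_* T M) (*-comm k M) ⟩
    M * k * T M      ≡⟨ *-assoc M k (T M) ⟩
    M * (k * T M)    ≤⟨ *-monoʳ-≤ M (multiples k) ⟩
    M * T (k * M)    ∎)
    where
    open ≤-Reasoning
    multiples : ∀ k → k * T M ≤ T (k * M)
    multiples zero    = z≤n
    multiples (suc k) = ≤-trans (+-monoʳ-≤ (T M) (multiples k)) (sup M (k * M))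

  -- If `n` is tight, the bounds for both pieces of its decomposition must be equalities. So a tight
  -- `n > m` is a tight `k ≤ m` plus a smaller tight `l`, and divisibility follows by induction.
  tight⇒∣ : ∀ {g} → (∀ i → 1 ≤ i → i ≤ m → Tight i → g ∣ i) → ∀ n → Tight n → g ∣ n
  tight⇒∣ {g} g∣ = <-rec _ step
    where
    small : ∀ n → n ≤ m → Tight n → g ∣ n
    small zero    _   _     = g ∣0
    small (suc n) n<m tight = g∣ (suc n) z<s n<m tight
    step : ∀ n → (∀ {j} → j < n → Tight j → g ∣ j) → Tight n → g ∣ n
    step n rec tight with n ≤? m
    ... | yes n≤m = small n n≤m tight
    ... | no  n≰m with dec n (≰⇒> n≰m)
    ...   | k , l , 1≤k , k≤m , refl , le =
      ∣m∣n⇒∣m+n (g∣ k 1≤k k≤m tight-k) (rec (m<n+m l 1≤k) tight-l)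
      where
      open ≤-Reasoning
      sum-≤ : k * T M + l * T M ≤ M * T k + M * T l
      sum-≤ = begin
        k * T M + l * T M  ≡⟨ *-distribʳ-+ (T M) k l ⟨
        (k + l) * T M      ≡⟨ tight ⟨
        M * T (k + l)      ≤⟨ *-monoʳ-≤ M le ⟩
        M * (T k + T l)    ≡⟨ *-distribˡ-+ M (T k) (T l) ⟩
        M * T k + M * T l  ∎
      tight-k : Tight k
      tight-k = ≤-antisym (average-≤ k)
        (+-cancelʳ-≤ (l * T M) _ _ (≤-trans sum-≤ (+-monoʳ-≤ (M * T k) (average-≤ l))))
      tight-l : Tight l
      tight-l = ≤-antisym (average-≤ l)
        (+-cancelˡ-≤ (k * T M) _ _ (≤-trans sum-≤ (+-monoˡ-≤ (M * T l) (average-≤ k))))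

  -- Beyond the window, decompose `n + i`, which exceeds `m`, by splitting off `k ≤ m`. Since
  -- `m ≤ n ∸ N`, the index `n ∸ k` is still at least `N`, so induction extracts `T i` from the
  -- remainder and superadditivity reunites `k` with `n ∸ k`.
  additive-persists : ∀ {N i} → m < N →
    (∀ j → j < m → T (N + j + i) ≡ T (N + j) + T i) →
    ∀ n → N ≤ n → T (n + i) ≡ T n + T i
  additive-persists {N} {i} m<N window = <-rec _ step
    where
    open ≤-Reasoning
    step : ∀ n → (∀ {j} → j < n → N ≤ j → T (j + i) ≡ T j + T i) → N ≤ n → T (n + i) ≡ T n + T i
    step n rec N≤n with n ∸ N <? m
    ... | yes n∸N<m = subst (λ x → T (x + i) ≡ T x + T i) (m+[n∸m]≡n N≤n) (window (n ∸ N) n∸N<m)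
    ... | no  n∸N≮m with dec (n + i) (<-≤-trans m<N (≤-trans N≤n (m≤m+n n i)))
    ...   | k , l , 1≤k , k≤m , k+l≡n+i , le = ≤-antisym upper (sup n i)
      where
      N≤n∸k : N ≤ n ∸ k
      N≤n∸k = m+n≤o⇒m≤o∸n N (≤-trans (+-monoʳ-≤ N (≤-trans k≤m (≮⇒≥ n∸N≮m))) (≤-reflexive (m+[n∸m]≡n N≤n)))
      k≤n : k ≤ n
      k≤n = ≤-trans k≤m (≤-trans (<⇒≤ m<N) N≤n)
      l≡ : l ≡ n ∸ k + i
      l≡ = +-cancelˡ-≡ k _ _ (trans k+l≡n+i (trans (cong (_+ i) (sym (m+[n∸m]≡n k≤n))) (+-assoc k _ i)))
      upper : T (n + i) ≤ T n + T i
      upper = begin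
        T (n + i)                 ≤⟨ le ⟩
        T k + T l                 ≡⟨ cong (λ x → T k + T x) l≡ ⟩
        T k + T (n ∸ k + i)       ≡⟨ cong (T k +_) (rec (∸-monoʳ-< 1≤k k≤n) N≤n∸k) ⟩
        T k + (T (n ∸ k) + T i)   ≡⟨ +-assoc (T k) _ _ ⟨
        T k + T (n ∸ k) + T i     ≤⟨ +-monoˡ-≤ (T i) (sup k (n ∸ k)) ⟩
        T (k + (n ∸ k)) + T i     ≡⟨ cong (λ x → T x + T i) (m+[n∸m]≡n k≤n) ⟩
        T n + T i                 ∎

  -- The gap between `T` and the line of maximal slope `T M / M`, scaled by `M`. The truncated
  -- subtraction is exact by `average-≤`.
  deficit : ℕ → ℕ
  deficit n = n * T M ∸ M * T n

  deficit-spec : ∀ n → deficit n + M * T n ≡ n * T M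
  deficit-spec n = m∸n+n≡m (average-≤ n)

  -- Free of subtraction, this says that a shift by a tight `i` lowers the deficit by `M` times the
  -- failure of additivity, `T (n + i)` minus `T n + T i`.
  deficit-shift : ∀ {i} → Tight i → ∀ n →
    deficit (n + i) + M * T (n + i) ≡ deficit n + M * (T n + T i)
  deficit-shift {i} tight n = begin
    deficit (n + i) + M * T (n + i)     ≡⟨ deficit-spec (n + i) ⟩
    (n + i) * T M                       ≡⟨ *-distribʳ-+ (T M) n i ⟩
    n * T M + i * T M                   ≡⟨ cong₂ _+_ (deficit-spec n) tight ⟨
    deficit n + M * T n + M * T i       ≡⟨ +-assoc (deficit n) _ _ ⟩
    deficit n + (M * T n + M * T i)     ≡⟨ cong (deficit n +_) (*-distribˡ-+ M (T n) (T i)) ⟨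
    deficit n + M * (T n + T i)         ∎
    where open ≡-Reasoning

  deficit-≤ : ∀ {i} → Tight i → ∀ n → deficit (n + i) ≤ deficit n
  deficit-≤ {i} tight n = +-cancelʳ-≤ (M * (T n + T i)) _ _
    (≤-trans (+-monoʳ-≤ (deficit (n + i)) (*-monoʳ-≤ M (sup n i))) (≤-reflexive (deficit-shift tight n)))

  module _ .{{_ : NonZero M}} where

    deficit-≡⇒additive : ∀ {i} → Tight i → ∀ n → deficit (n + i) ≡ deficit n → T (n + i) ≡ T n + T i
    deficit-≡⇒additive {i} tight n eq = *-cancelˡ-≡ _ _ M
      (+-cancelˡ-≡ (deficit n) _ _ (trans (cong (_+ M * T (n + i)) (sym eq)) (deficit-shift tight n)))

    -- The total deficit over m consecutive indices does not increase under a shift by i,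
    -- so after finitely many shifts it is stationary.
    eventually-additive : ∀ {i} → Tight i → ∃[ N ] ∀ n → N ≤ n → T (n + i) ≡ T n + T i
    -- The start `suc m` meets the requirement `m < N` of `additive-persists`; the window sum is the
    -- measure of termination.
    eventually-additive {i} tight = search (suc m) (n<1+n m) (<-wellFounded _)
      where
      window : ℕ → ℕ → ℕ
      window N j = deficit (N + j)

      window-≤ : ∀ N j → window (N + i) j ≤ window N j
      window-≤ N j = subst (λ x → deficit x ≤ window N j) (sym (xy∙z≈xz∙y N i j)) (deficit-≤ tight (N + j))

      search : ∀ N → m < N → Acc _<_ (S (window N) m) → ∃[ N′ ] ∀ n → N′ ≤ n → T (n + i) ≡ T n + T i
      search N m<N (acc rs) with ≤-pointwise-S m (window-≤ N)
      ... | inj₂ lt = search (N + i) (≤-trans m<N (m≤m+n N i)) (rs lt)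
      ... | inj₁ eq = N , additive-persists m<N λ j j<m →
        deficit-≡⇒additive tight (N + j) (trans (cong deficit (sym (xy∙z≈xz∙y N i j))) (eq j j<m))

    -- Start at `N * M`, which is tight and at least `N`. After `M` shifts by `d` the index is
    -- `(N + d) * M`, again tight. Comparing the two gives `M * c ≡ d * T M`: each shift grows at
    -- the maximal average, so already the first one lands on a tight index.
    additive-period-tight : ∀ {N d c} → (∀ n → N ≤ n → T (n + d) ≡ T n + c) → Tight (N * M + d)
    additive-period-tight {N} {d} {c} shift = begin
      M * T (N * M + d)        ≡⟨ cong (M *_) (shift (N * M) (m≤m*n N M)) ⟩
      M * (T (N * M) + c)      ≡⟨ *-distribˡ-+ M (T (N * M)) c ⟩
      M * T (N * M) + M * c    ≡⟨ cong₂ _+_ (tight-* N) Mc≡dTM ⟩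
      N * M * T M + d * T M    ≡⟨ *-distribʳ-+ (T M) (N * M) d ⟨
      (N * M + d) * T M        ∎
      where
      open ≡-Reasoning
      shifts : ∀ k → T (N * M + k * d) ≡ T (N * M) + k * c
      shifts zero    = trans (cong T (+-identityʳ (N * M))) (sym (+-identityʳ _))
      shifts (suc k) = begin
        T (N * M + (d + k * d))    ≡⟨ cong T (x∙yz≈xz∙y (N * M) d (k * d)) ⟩
        T (N * M + k * d + d)      ≡⟨ shift _ (≤-trans (m≤m*n N M) (m≤m+n (N * M) (k * d))) ⟩
        T (N * M + k * d) + c      ≡⟨ cong (_+ c) (shifts k) ⟩
        T (N * M) + k * c + c      ≡⟨ x∙yz≈xz∙y (T (N * M)) c (k * c) ⟨
        T (N * M) + (c + k * c)    ∎
      merge : N * M + M * d ≡ (N + d) * M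
      merge = trans (cong (N * M +_) (*-comm M d)) (sym (*-distribʳ-+ M N d))
      scaled : M * T (N * M) + M * (M * c) ≡ M * T (N * M) + M * (d * T M)
      scaled = begin
        M * T (N * M) + M * (M * c)      ≡⟨ *-distribˡ-+ M (T (N * M)) (M * c) ⟨
        M * (T (N * M) + M * c)          ≡⟨ cong (M *_) (shifts M) ⟨
        M * T (N * M + M * d)            ≡⟨ cong (λ x → M * T x) merge ⟩
        M * T ((N + d) * M)              ≡⟨ tight-* (N + d) ⟩
        (N + d) * M * T M                ≡⟨ expand N d M (T M) ⟩
        N * M * T M + M * (d * T M)      ≡⟨ cong (_+ M * (d * T M)) (tight-* N) ⟨
        M * T (N * M) + M * (d * T M)    ∎
        where
        expand : ∀ n d m t → (n + d) * m * t ≡ n * m * t + m * (d * t)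
        expand = solve-∀
      Mc≡dTM : M * c ≡ d * T M
      Mc≡dTM = *-cancelˡ-≡ _ _ M (+-cancelˡ-≡ (M * T (N * M)) _ _ scaled)

-- Eventual periods and their gcds

EventualPeriod : Seq → ℕ → Set
EventualPeriod e d = ∃[ N ] ∀ n → N ≤ n → e (n + d) ≡ e n

shift-* : ∀ (e : Seq) {d N} → (∀ n → N ≤ n → e (n + d) ≡ e n) → ∀ k n → N ≤ n → e (n + k * d) ≡ e n
shift-* e per zero    n N≤n = cong e (+-identityʳ n)
shift-* e {d} per (suc k) n N≤n = trans (cong e (sym (+-assoc n d (k * d))))
  (trans (shift-* e per k (n + d) (≤-trans N≤n (m≤m+n n d))) (per n N≤n))

-- Bézout over ℕ gives `g + p ≡ q`, where `p` is a multiple of one period and `q` of the other.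
-- Going up from `n + g` by `p` and from `n` by `q` reaches the same index.
eventualPeriod-gcd : ∀ e {a b} → EventualPeriod e a → EventualPeriod e b → EventualPeriod e (gcd a b)
eventualPeriod-gcd e {a} {b} (N₁ , per₁) (N₂ , per₂) = N₁ + N₂ , λ n N≤n →
  let N₁≤n = m+n≤o⇒m≤o N₁ N≤n
      N₂≤n = m+n≤o⇒n≤o N₁ N≤n
  in bézout n N₁≤n N₂≤n (Bézout.identity (gcd-GCD a b))
  where
  g = gcd a b
  combine : ∀ n p q → e (n + g + p) ≡ e (n + g) → e (n + q) ≡ e n → g + p ≡ q → e (n + g) ≡ e n
  combine n p q shift-p shift-q eq =
    trans (sym shift-p) (trans (cong e (trans (+-assoc n g p) (cong (n +_) eq))) shift-q)
  bézout : ∀ n → N₁ ≤ n → N₂ ≤ n → Bézout.Identity.Identity g a b → e (n + g) ≡ e n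
  bézout n N₁≤n N₂≤n (Bézout.+- x y eq) = combine n (y * b) (x * a)
    (shift-* e per₂ y (n + g) (≤-trans N₂≤n (m≤m+n n g))) (shift-* e per₁ x n N₁≤n) eq
  bézout n N₁≤n N₂≤n (Bézout.-+ x y eq) = combine n (x * a) (y * b)
    (shift-* e per₁ x (n + g) (≤-trans N₁≤n (m≤m+n n g))) (shift-* e per₂ y n N₂≤n) eq

eventualPeriod-gcdList : ∀ e {xs} → (∀ {i} → i ∈ xs → EventualPeriod e i) → EventualPeriod e (gcdList xs)
-- The base value 0 of the fold is trivially an eventual period, since `EventualPeriod` admits
-- `d = 0`.
eventualPeriod-gcdList e {[]}     _   = 0 , λ n _ → cong e (+-identityʳ n)
eventualPeriod-gcdList e {x ∷ xs} per =
  eventualPeriod-gcd e (per (here refl)) (eventualPeriod-gcdList e (per ∘ there))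

gcdList-∣ : ∀ {i xs} → i ∈ xs → gcdList xs ∣ i
gcdList-∣ {xs = x ∷ xs} (here refl) = gcd[m,n]∣m x (gcdList xs)
gcdList-∣ {xs = x ∷ xs} (there i∈)  = ∣-trans (gcd[m,n]∣n x (gcdList xs)) (gcdList-∣ i∈)

-- Eventual periods and preperiod-period representations

++ˢ-+ : ∀ {p} (η : Vec ℕ p) e i → (η ++ˢ e) (p + i) ≡ e i
++ˢ-+ []      e i = refl
++ˢ-+ (x ∷ η) e i = ++ˢ-+ η e i

tabulate-++ˢ : ∀ N e e′ → (∀ i → e (N + i) ≡ e′ i) → e ≗ tabulate {n = N} (e ∘ toℕ) ++ˢ e′
tabulate-++ˢ zero    e e′ eq i       = eq i
tabulate-++ˢ (suc N) e e′ eq zero    = refl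
tabulate-++ˢ (suc N) e e′ eq (suc i) = tabulate-++ˢ N (e ∘ suc) e′ eq i

eventualPeriod⇒isPeriod : ∀ e {d} → .{{NonZero d}} → EventualPeriod e d → IsPeriod e d
eventualPeriod⇒isPeriod e {suc d-1} (N , per) = record
  { η₀ = tabulate {n = N} (e ∘ toℕ)
  ; η₁ = tabulate cycle
  ; representation = tabulate-++ˢ N e _ λ i → begin
      e (N + i)                        ≡⟨ cong (λ x → e (N + x)) (m≡m%n+[m/n]*n i d) ⟩
      e (N + (i % d + i / d * d))      ≡⟨ cong e (+-assoc N (i % d) (i / d * d)) ⟨
      e (N + i % d + i / d * d)        ≡⟨ shift-* e per (i / d) (N + i % d) (m≤m+n N (i % d)) ⟩
      e (N + i % d)                    ≡⟨ cong (λ x → e (N + x)) (toℕ-fromℕ< (m%n<n i d)) ⟨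
      e (N + toℕ (i mod d))            ≡⟨ lookup∘tabulate cycle (i mod d) ⟨
      (tabulate cycle ^∞) i            ∎
  }
  where
  open ≡-Reasoning
  d = suc d-1
  cycle : Fin d → ℕ
  cycle j = e (N + toℕ j)

isPeriod⇒eventualPeriod : ∀ {e d} → IsPeriod e d → EventualPeriod e d
isPeriod⇒eventualPeriod {e} {d} isPer = preperiod , λ n p≤n →
  subst (λ x → e (x + d) ≡ e x) (m+[n∸m]≡n p≤n) (beyond (n ∸ preperiod))
  where
  open IsPeriod isPer
  open ≡-Reasoning
  ^∞-shift : ∀ i → (η₁ ^∞) (i + d) ≡ (η₁ ^∞) i
  ^∞-shift i = cong (lookup η₁) (toℕ-injective
    (trans (toℕ-fromℕ< (m%n<n (i + d) d))
      (trans ([m+n]%n≡m%n i d) (sym (toℕ-fromℕ< (m%n<n i d))))))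
  beyond : ∀ i → e (preperiod + i + d) ≡ e (preperiod + i)
  beyond i = begin
    e (preperiod + i + d)                   ≡⟨ cong e (+-assoc preperiod i d) ⟩
    e (preperiod + (i + d))                 ≡⟨ representation _ ⟩
    (η₀ ++ˢ η₁ ^∞) (preperiod + (i + d))    ≡⟨ ++ˢ-+ η₀ (η₁ ^∞) (i + d) ⟩
    (η₁ ^∞) (i + d)                         ≡⟨ ^∞-shift i ⟩
    (η₁ ^∞) i                               ≡⟨ ++ˢ-+ η₀ (η₁ ^∞) i ⟨
    (η₀ ++ˢ η₁ ^∞) (preperiod + i)          ≡⟨ representation _ ⟨
    e (preperiod + i)                       ∎

-- Eventual periods seen on partial sums

additive⇒eventualPeriod : ∀ e {d c} → (∃[ N ] ∀ n → N ≤ n → S e (n + d) ≡ S e n + c) → EventualPeriod e d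
-- The shift relations at `n` and `suc n` differ exactly by the terms `e (n + d)` and `e n`.
additive⇒eventualPeriod e {d} {c} (N , shift) = N , λ n N≤n → +-cancelˡ-≡ (S e n + c) _ _ (begin
  S e n + c + e (n + d)      ≡⟨ cong (_+ e (n + d)) (shift n N≤n) ⟨
  S e (n + d) + e (n + d)    ≡⟨ S-suc e (n + d) ⟨
  S e (suc n + d)            ≡⟨ shift (suc n) (m≤n⇒m≤1+n N≤n) ⟩
  S e (suc n) + c            ≡⟨ cong (_+ c) (S-suc e n) ⟩
  S e n + e n + c            ≡⟨ xy∙z≈xz∙y (S e n) (e n) c ⟩
  S e n + c + e n            ∎)
  where
  open ≡-Reasoning

eventualPeriod⇒additive : ∀ e {d} → EventualPeriod e d → ∃[ N ] ∃[ c ] ∀ n → N ≤ n → S e (n + d) ≡ S e n + c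
eventualPeriod⇒additive e {d} (N , per) = N , c , λ n N≤n →
  subst (λ x → S e (x + d) ≡ S e x + c) (m+[n∸m]≡n N≤n) (from (n ∸ N))
  where
  open ≡-Reasoning
  c = S (λ i → e (N + i)) d
  from : ∀ j → S e (N + j + d) ≡ S e (N + j) + c
  from zero    = subst (λ x → S e (x + d) ≡ S e x + c) (sym (+-identityʳ N)) (S-+ e N d)
  from (suc j) = subst (λ x → S e (x + d) ≡ S e x + c) (sym (+-suc N j)) (begin
    S e (suc (N + j + d))                  ≡⟨ S-suc e (N + j + d) ⟩
    S e (N + j + d) + e (N + j + d)        ≡⟨ cong₂ _+_ (from j) (per (N + j) (m≤m+n N j)) ⟩
    S e (N + j) + c + e (N + j)            ≡⟨ xy∙z≈xz∙y (S e (N + j)) c (e (N + j)) ⟩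
    S e (N + j) + e (N + j) + c            ≡⟨ cong (_+ c) (S-suc e (N + j)) ⟨
    S e (suc (N + j)) + c                  ∎)

-- Rational averages and maximisers

/-≤⁻ : ∀ (a b i j : ℕ) → (ℤ.+ a) ℚ./ suc i ℚ.≤ (ℤ.+ b) ℚ./ suc j → a * suc j ≤ b * suc i
-- The normalised fractions are `fromℚᵘ p` and `fromℚᵘ q` by definition; on the unnormalised `p` and
-- `q` the order is cross-multiplication.
/-≤⁻ a b i j le = ℤ.drop‿+≤+ (subst₂ ℤ._≤_ (sym (ℤ.pos-* a (suc j))) (sym (ℤ.pos-* b (suc i)))
  (ℚᵘ.drop-*≤* (ℚᵘ.≤-respʳ-≃ (ℚ.toℚᵘ-fromℚᵘ q)
    (ℚᵘ.≤-respˡ-≃ (ℚ.toℚᵘ-fromℚᵘ p) (ℚ.toℚᵘ-mono-≤ {fromℚᵘ p} {fromℚᵘ q} le)))))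
  where
  p = mkℚᵘ (ℤ.+ a) i
  q = mkℚᵘ (ℤ.+ b) j

/-≡⁺ : ∀ (a b i j : ℕ) → a * suc j ≡ b * suc i → (ℤ.+ a) ℚ./ suc i ≡ (ℤ.+ b) ℚ./ suc j
/-≡⁺ a b i j eq = ℚ.fromℚᵘ-cong {mkℚᵘ (ℤ.+ a) i} {mkℚᵘ (ℤ.+ b) j}
  (*≡* (trans (sym (ℤ.pos-* a (suc j))) (trans (cong ℤ.+_ eq) (ℤ.pos-* b (suc i)))))

A-≤⁻ : ∀ e i j → A e (suc i) ℚ.≤ A e (suc j) → suc j * S e (suc i) ≤ suc i * S e (suc j)
A-≤⁻ e i j le = subst₂ _≤_ (*-comm (S e (suc i)) (suc j)) (*-comm (S e (suc j)) (suc i))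
  (/-≤⁻ (S e (suc i)) (S e (suc j)) i j le)

A-≡⁺ : ∀ e i j → suc j * S e (suc i) ≡ suc i * S e (suc j) → A e (suc i) ≡ A e (suc j)
A-≡⁺ e i j eq = /-≡⁺ (S e (suc i)) (S e (suc j)) i j
  (trans (*-comm (S e (suc i)) (suc j)) (trans eq (*-comm (suc i) (S e (suc j)))))

A-≤-Amax : ∀ e {m j} → j < m → A e (suc j) ℚ.≤ Amax e m
A-≤-Amax e j<m = All.lookup (xs≤max (A e 1) (applyUpTo (λ j → A e (suc j)) _)) (∈-applyUpTo⁺ (λ j → A e (suc j)) j<m)

Amax-sel : ∀ e m → Amax e m ≡ A e 1 ⊎ Amax e m ∈ applyUpTo (λ j → A e (suc j)) m
Amax-sel e m = argmax-sel id (A e 1) (applyUpTo (λ j → A e (suc j)) m)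

Amax-attained : ∀ e m → .{{NonZero m}} → ∃[ j ] j < m × A e (suc j) ≡ Amax e m
-- If `max` returns its default `A e 1`, the index 0 attains it, and `0 < m` because `m` is nonzero.
Amax-attained e m = [ (λ eq → 0 , >-nonZero⁻¹ m , sym eq) , attained ]′ (Amax-sel e m)
  where
  attained : Amax e m ∈ applyUpTo (λ j → A e (suc j)) m → ∃[ j ] j < m × A e (suc j) ≡ Amax e m
  attained ∈xs = let j , j<m , eq = ∈-applyUpTo⁻ (λ j → A e (suc j)) ∈xs in j , j<m , sym eq

∈-maximisers⁻ : ∀ e m {i} → i ∈ maximisers e m → ∃[ j ] i ≡ suc j × A e (suc j) ≡ Amax e m
∈-maximisers⁻ e m i∈ =
  let j , _ , i≡1+j , eq = ∈-map∘filter⁻ suc (λ j → A e (suc j) ℚ.≟ Amax e m) {xs = upTo m} i∈ in j , i≡1+j , eq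

∈-maximisers⁺ : ∀ e {m j} → j < m → A e (suc j) ≡ Amax e m → suc j ∈ maximisers e m
∈-maximisers⁺ e {m} {j} j<m eq =
  ∈-map∘filter⁺ suc (λ j → A e (suc j) ℚ.≟ Amax e m) (j , ∈-upTo⁺ j<m , refl , eq)

-- The gcd of the maximisers is the minimal period

maximiser⇒isMinimalPeriod : ∀ {m} → .{{_ : NonZero m}} → {η : Vec ℕ m} {e : Seq} →
  IsLexMinExtension η e →
  ∀ {j} → j < m → A e (suc j) ≡ Amax e m → IsMinimalPeriod e (gcdList (maximisers e m))
maximiser⇒isMinimalPeriod {m} {e = e} lexMin {M-1} M-1<m AM≡Amax = record
  { isPeriod = eventualPeriod⇒isPeriod e {{g≢0}} (eventualPeriod-gcdList e λ {i} i∈ →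
      additive⇒eventualPeriod e {i} (eventually-additive (∈⇒tight i∈)))
  -- Minimality comes in the stronger form that the gcd divides every period; periods are nonzero,
  -- so it is also at most each of them.
  ; least = λ d isPer → ∣⇒≤ {{IsPeriod.d≢0 isPer}} (g∣period d isPer)
  }
  where
  M = suc M-1
  g = gcdList (maximisers e m)

  maximal : ∀ i → 1 ≤ i → i ≤ m → M * S e i ≤ i * S e M
  maximal (suc i) _ i<m = A-≤⁻ e i M-1 (subst (A e (suc i) ℚ.≤_) (sym AM≡Amax) (A-≤-Amax e i<m))

  open MaximalAverage {S e} {m} {M}
    (binomid⇒superadditive (IsExtension.binomid (IsLexMinExtension.isExtension lexMin)))
    (lexMin⇒decomposableBeyond lexMin) maximal

  ∈⇒tight : ∀ {i} → i ∈ maximisers e m → Tight i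
  ∈⇒tight i∈ =
    let j , i≡1+j , Aj≡Amax = ∈-maximisers⁻ e m i∈
        Aj≡AM = trans Aj≡Amax (sym AM≡Amax)
    in subst Tight (sym i≡1+j)
         (≤-antisym (A-≤⁻ e j M-1 (ℚ.≤-reflexive Aj≡AM)) (A-≤⁻ e M-1 j (ℚ.≤-reflexive (sym Aj≡AM))))

  tight⇒g∣ : ∀ i → 1 ≤ i → i ≤ m → Tight i → g ∣ i
  tight⇒g∣ (suc i) _ i<m tight = gcdList-∣ (∈-maximisers⁺ e i<m (trans (A-≡⁺ e i M-1 tight) AM≡Amax))

  g∣M : g ∣ M
  g∣M = tight⇒g∣ M z<s M-1<m refl

  g≢0 : NonZero g
  -- The gcd divides the positive maximiser `M`, so it cannot be the value 0 of the empty fold.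
  g≢0 = ≢-nonZero λ g≡0 → contradiction (0∣⇒≡0 (subst (_∣ M) g≡0 g∣M)) λ ()

  g∣period : ∀ d → IsPeriod e d → g ∣ d
  g∣period d isPer =
    let N , c , shift = eventualPeriod⇒additive e (isPeriod⇒eventualPeriod isPer)
    -- The gcd divides the tight index `N * M + d` and also `N * M`, hence the difference `d`.
    in ∣m+n∣m⇒∣n (tight⇒∣ tight⇒g∣ (N * M + d) (additive-period-tight {N} {d} {c} shift)) (∣n⇒∣m*n N g∣M)

theorem3p4 : ∀ (m : ℕ) → .{{_ : NonZero m}} → (η : Vec ℕ m) → IsFiniteBinomidIndex η →
    (η̃ : Seq) → IsLexMinExtension η η̃ →
    IsMinimalPeriod η̃ (gcdList (maximisers η̃ m))
theorem3p4 m η _ η̃ lexMin =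
  let _ , j<m , Aj≡Amax = Amax-attained η̃ m in maximiser⇒isMinimalPeriod lexMin j<m Aj≡Amax
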